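{- Let $n,m\ge 0$ be integers with $2n+m\ge 3$, and let $\mathcal{P}_4$ denote the family of triangle-free planar simple graphs. Then $$\chi_{n,m}(\mathcal{P}_4)\ge 2(2n+m)^2+2.$$
   Context: An $(n,m)$-graph $G$ is a graph with $n$ different types of arcs (directed edges) and $m$ different types of edges (undirected), whose underlying graph $und(G)$ (forget types and directions) is a simple graph; each pair of adjacent vertices is joined by exactly one arc or edge, which has one type. A homomorphism of an $(n,m)$-graph $G$ to an $(n,m)$-graph $H$ is a map $f:V(G)\to V(H)$ such that for every arc $xy$ (from $x$ to $y$) of type $i$ in $G$, $f(x)f(y)$ is an arc of type $i$ from $f(x)$ to $f(y)$ in $H$, and for every edge $xy$ of type $j$ in $G$, $f(x)f(y)$ is an edge of type $j$ in $H$. The $(n,m)$-chromatic number of an $(n,m)$-graph $G$ is $\chi_{n,m}(G)=\min\{|V(H)|: H \text{ an } (n,m)\text{ -graph and there is a homomorphism of } G \text{ to } H\}$. For a family $\mathcal{F}$ of simple graphs, $\chi_{n,m}(\mathcal{F})=\max\{\chi_{n,m}(G): G \text{ an } (n,m)\text{ -graph with } und(G)\in\mathcal{F}\}$. -}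

module Defs where

open import Data.Nat using (ℕ; _≤_; _+_; _*_; _^_)
open import Data.Fin using (Fin)
open import Data.Maybe using (Maybe; just; nothing; map)
open import Data.Product using (Σ; ∃; _×_; _,_)
open import Data.Sum using (_⊎_)
open import Data.Empty using (⊥)
open import Relation.Nullary using (¬_)
open import Relation.Binary.PropositionalEquality using (_≡_)
open import Data.Rational as ℚ using (ℚ; 0ℚ; 1ℚ)

-- (n,m)-graphs on a finite vertex set Fin size.
-- The label of the ordered pair (x , y) records what joins x and y:
--   arcOut i : an arc of type i from x to y
--   arcIn  i : an arc of type i from y to x
--   edge   j : an (undirected) edge of type j
--   nothing  : x and y are not adjacent

data Lab (n m : ℕ) : Set where
  arcOut : Fin n → Lab n m
  arcIn  : Fin n → Lab n m
  edge   : Fin m → Lab n m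

flipLab : ∀ {n m} → Lab n m → Lab n m
flipLab (arcOut i) = arcIn i
flipLab (arcIn i)  = arcOut i
flipLab (edge j)   = edge j

record NMGraph (n m : ℕ) : Set where
  field
    size   : ℕ
    lab    : Fin size → Fin size → Maybe (Lab n m)
    noLoop : ∀ x → lab x x ≡ nothing
    labSym : ∀ x y → lab y x ≡ map flipLab (lab x y)

open NMGraph public

Adj : ∀ {n m} (G : NMGraph n m) → Fin (size G) → Fin (size G) → Set
Adj G x y = ∃ λ l → lab G x y ≡ just l

Hom : ∀ {n m} → NMGraph n m → NMGraph n m → Set
Hom G H = Σ (Fin (size G) → Fin (size H)) λ f →
  ∀ x y l → lab G x y ≡ just l → lab H (f x) (f y) ≡ just l

ChromaticAtLeast : ∀ {n m} → NMGraph n m → ℕ → Set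
ChromaticAtLeast {n} {m} G k = ∀ (H : NMGraph n m) → Hom G H → k ≤ size H

TriangleFree : ∀ {n m} → NMGraph n m → Set
TriangleFree G = ∀ x y z → Adj G x y → Adj G y z → Adj G x z → ⊥

-- Planarity, via straight-line drawings with rational coordinates
-- (equivalent to planarity by Fáry's theorem plus perturbation).

Point : Set
Point = ℚ × ℚ

comb : ℚ → Point → Point → Point
comb t (a₁ , a₂) (b₁ , b₂) =
  ((1ℚ ℚ.- t) ℚ.* a₁ ℚ.+ t ℚ.* b₁ , (1ℚ ℚ.- t) ℚ.* a₂ ℚ.+ t ℚ.* b₂)

OnSeg : Point → Point → Point → Set
OnSeg P A B = Σ ℚ λ t → (0ℚ ℚ.≤ t) × (t ℚ.≤ 1ℚ) × (P ≡ comb t A B)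

record StraightLineEmbedding {n m} (G : NMGraph n m) : Set where
  field
    pos      : Fin (size G) → Point
    pos-inj  : ∀ x y → pos x ≡ pos y → x ≡ y
    vtx-edge : ∀ v a b → Adj G a b → OnSeg (pos v) (pos a) (pos b) →
               (v ≡ a) ⊎ (v ≡ b)
    edge-edge : ∀ a b c d → Adj G a b → Adj G c d →
               ¬ ((a ≡ c) × (b ≡ d)) → ¬ ((a ≡ d) × (b ≡ c)) →
               ∀ P → OnSeg P (pos a) (pos b) → OnSeg P (pos c) (pos d) →
               Σ (Fin (size G)) λ v → ((v ≡ a) ⊎ (v ≡ b)) ×
                                      ((v ≡ c) ⊎ (v ≡ d)) × (P ≡ pos v)

Planar : ∀ {n m} → NMGraph n m → Set
Planar G = StraightLineEmbedding G

-- Join two hubs to 2p² rims, two rims for each pair of the p = 2n + m possible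
-- labels (α , β) towards the hubs, and add a middle vertex between the two rims
-- of each pair, with different labels to them.  Rims with different label pairs
-- have different images under a homomorphism because of a hub, rims with the
-- same label pair because of their middle vertex, the hubs because of a rim with
-- α ≢ β, and a hub and a rim because they are adjacent: 2p² + 2 images in all.
-- Every edge has exactly one rim as an end, so there are no triangles, and with
-- the hubs at (0 , ±1) and each pair of rims, its middle vertex in between, at
-- consecutive integers on the x-axis, no two edges cross.
module Submission where

open import Defs
open import Data.Nat as ℕ using (ℕ; zero; suc; _≤_; _+_; _*_; _^_)
import Data.Nat.Properties as ℕ
open import Data.Bool using (Bool; true; false)
open import Data.Product using (Σ; ∃; _×_; _,_; proj₁; proj₂)
open import Data.Sum using (_⊎_; inj₁; inj₂; [_,_]; map₂)
open import Data.Sum.Function.Propositional using (_⊎-↔_)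
open import Data.Empty using (⊥-elim)
open import Data.Fin as Fin using (Fin; toℕ; combine; remQuot)
open import Data.Fin.Patterns using (0F; 1F; 2F)
import Data.Fin.Properties as Fin
open import Data.Maybe as Maybe using (Maybe; just; nothing)
import Data.Maybe.Properties as Maybe
open import Data.Rational as ℚ using (ℚ; 0ℚ; 1ℚ)
import Data.Rational.Properties as ℚ
open import Data.Rational.Solver using (module +-*-Solver)
open import Function using (_∘_; _↔_; Inverse; Injection)
open import Function.Construct.Identity using (↔-id)
open import Function.Construct.Composition using (_↔-∘_)
open import Function.Properties.Inverse using (↔⇒↣)
open import Relation.Nullary using (¬_; contradiction; yes; no)
open import Relation.Binary.Definitions using (tri<; tri≈; tri>)
open import Relation.Binary.PropositionalEquality
  using (_≡_; _≢_; refl; sym; trans; cong; cong₂; subst; subst₂)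
open +-*-Solver using (solve; _:+_; _:*_; _:-_; _:=_; con)

-- Natural numbers inside the rationals.

-- Built by repeated addition of `1ℚ`, so that a link, running from `ι k` to `ι k + 1ℚ`, is
-- parametrised by a ring identity.
ι : ℕ → ℚ
ι zero    = 0ℚ
ι (suc k) = ι k ℚ.+ 1ℚ

ι-step : ∀ k → ι k ℚ.< ι (suc k)
ι-step k = subst (ℚ._< ι (suc k)) (ℚ.+-identityʳ (ι k))
  (ℚ.+-monoʳ-< (ι k) (ℚ.positive⁻¹ 1ℚ))

ι-mono-≤′ : ∀ {k l} → k ℕ.≤′ l → ι k ℚ.≤ ι l
ι-mono-≤′ (ℕ.≤′-reflexive refl) = ℚ.≤-refl
ι-mono-≤′ (ℕ.≤′-step {n} k≤n)   = ℚ.≤-trans (ι-mono-≤′ k≤n) (ℚ.<⇒≤ (ι-step n))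

ι-mono-≤ : ∀ {k l} → k ≤ l → ι k ℚ.≤ ι l
ι-mono-≤ = ι-mono-≤′ ∘ ℕ.≤⇒≤′

ι-cancel-≤ : ∀ {k l} → ι k ℚ.≤ ι l → k ≤ l
ι-cancel-≤ {k} {l} ιk≤ιl with k ℕ.≤? l
... | yes k≤l = k≤l
... | no  k≰l = contradiction
  (ℚ.<-≤-trans (ι-step l) (ℚ.≤-trans (ι-mono-≤ (ℕ.≰⇒> k≰l)) ιk≤ιl)) (ℚ.<-irrefl refl)

ι-injective : ∀ {k l} → ι k ≡ ι l → k ≡ l
ι-injective eq = ℕ.≤-antisym (ι-cancel-≤ (ℚ.≤-reflexive eq)) (ι-cancel-≤ (ℚ.≤-reflexive (sym eq)))

-- Parametrised segments.

comb-0 : ∀ {t} → t ≡ 0ℚ → ∀ A B → comb t A B ≡ A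
comb-0 refl (a₁ , a₂) (b₁ , b₂) = cong₂ _,_ (eq a₁ b₁) (eq a₂ b₂)
  where
  eq : ∀ a b → (1ℚ ℚ.- 0ℚ) ℚ.* a ℚ.+ 0ℚ ℚ.* b ≡ a
  eq = solve 2 (λ a b → (con 1ℚ :- con 0ℚ) :* a :+ con 0ℚ :* b := a) refl

comb-1 : ∀ {t} → t ≡ 1ℚ → ∀ A B → comb t A B ≡ B
comb-1 refl (a₁ , a₂) (b₁ , b₂) = cong₂ _,_ (eq a₁ b₁) (eq a₂ b₂)
  where
  eq : ∀ a b → (1ℚ ℚ.- 1ℚ) ℚ.* a ℚ.+ 1ℚ ℚ.* b ≡ b
  eq = solve 2 (λ a b → (con 1ℚ :- con 1ℚ) :* a :+ con 1ℚ :* b := b) refl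

comb-swap : ∀ t A B → comb (1ℚ ℚ.- t) A B ≡ comb t B A
comb-swap t (a₁ , a₂) (b₁ , b₂) = cong₂ _,_ (eq t a₁ b₁) (eq t a₂ b₂)
  where
  eq : ∀ t a b → (1ℚ ℚ.- (1ℚ ℚ.- t)) ℚ.* a ℚ.+ (1ℚ ℚ.- t) ℚ.* b ≡ (1ℚ ℚ.- t) ℚ.* b ℚ.+ t ℚ.* a
  eq = solve 3 (λ t a b → (con 1ℚ :- (con 1ℚ :- t)) :* a :+ (con 1ℚ :- t) :* b
                            := (con 1ℚ :- t) :* b :+ t :* a) refl

p≤1⇒0≤1-p : ∀ {p} → p ℚ.≤ 1ℚ → 0ℚ ℚ.≤ 1ℚ ℚ.- p
p≤1⇒0≤1-p {p} p≤1 = subst (ℚ._≤ 1ℚ ℚ.- p) (ℚ.+-inverseʳ p) (ℚ.+-monoˡ-≤ (ℚ.- p) p≤1)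

0≤p⇒1-p≤1 : ∀ {p} → 0ℚ ℚ.≤ p → 1ℚ ℚ.- p ℚ.≤ 1ℚ
0≤p⇒1-p≤1 {p} 0≤p = ℚ.+-monoʳ-≤ 1ℚ (ℚ.neg-antimono-≤ 0≤p)

OnSeg-sym : ∀ {P A B} → OnSeg P A B → OnSeg P B A
OnSeg-sym {P} {A} {B} (t , 0≤t , t≤1 , P≡) =
  1ℚ ℚ.- t , p≤1⇒0≤1-p t≤1 , 0≤p⇒1-p≤1 0≤t , trans P≡ (sym (comb-swap t B A))

-- Crossings in the infinite graph.

-- An infinite planar graph: the integers on the x-axis, consecutive ones
-- linked, all of them joined by spokes to the poles (0 , 1) and (0 , -1).
-- Finite graphs inherit planarity from it by being placed inside it.

data Site : Set where
  pole : Fin 2 → Site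
  axis : ℕ → Site

data Segment : Set where
  spoke : Fin 2 → ℕ → Segment
  link  : ℕ → Segment

source target : Segment → Site
source (spoke b k) = pole b
source (link k)    = axis k
target (spoke b k) = axis k
target (link k)    = axis (suc k)

Endpoint : Site → Segment → Set
Endpoint q s = q ≡ source s ⊎ q ≡ target s

height : Fin 2 → ℚ
height 0F = 1ℚ
height 1F = ℚ.- 1ℚ

draw : Site → Point
draw (pole b) = 0ℚ , height b
draw (axis k) = ι k , 0ℚ

_∈ₛ_ : Point → Segment → Set
P ∈ₛ s = OnSeg P (draw (source s)) (draw (target s))

draw-injective : ∀ {q r} → draw q ≡ draw r → q ≡ r
draw-injective {pole 0F} {pole 0F} _  = refl
draw-injective {pole 1F} {pole 1F} _  = refl
draw-injective {pole 0F} {pole 1F} eq with () ← cong proj₂ eq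
draw-injective {pole 1F} {pole 0F} eq with () ← cong proj₂ eq
draw-injective {pole 0F} {axis k}  eq with () ← cong proj₂ eq
draw-injective {pole 1F} {axis k}  eq with () ← cong proj₂ eq
draw-injective {axis k}  {pole 0F} eq with () ← cong proj₂ eq
draw-injective {axis k}  {pole 1F} eq with () ← cong proj₂ eq
draw-injective {axis k}  {axis l}  eq = cong axis (ι-injective (cong proj₁ eq))

axis-injective : ∀ {k l} → axis k ≡ axis l → k ≡ l
axis-injective refl = refl

spoke-point : ∀ b k t → comb t (draw (pole b)) (draw (axis k)) ≡ (t ℚ.* ι k , (1ℚ ℚ.- t) ℚ.* height b)
spoke-point b k t = cong₂ _,_
  (solve 2 (λ t a → (con 1ℚ :- t) :* con 0ℚ :+ t :* a := t :* a) refl t (ι k))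
  (solve 2 (λ t h → (con 1ℚ :- t) :* h :+ t :* con 0ℚ := (con 1ℚ :- t) :* h) refl t (height b))

link-point : ∀ k t → comb t (draw (axis k)) (draw (axis (suc k))) ≡ (ι k ℚ.+ t , 0ℚ)
link-point k t = cong₂ _,_
  (solve 2 (λ t a → (con 1ℚ :- t) :* a :+ t :* (a :+ con 1ℚ) := a :+ t) refl t (ι k))
  (solve 1 (λ t → (con 1ℚ :- t) :* con 0ℚ :+ t :* con 0ℚ := con 0ℚ) refl t)

∈link⇒bounds : ∀ k {P} → P ∈ₛ link k → ι k ℚ.≤ proj₁ P × proj₁ P ℚ.≤ ι (suc k) × proj₂ P ≡ 0ℚ
∈link⇒bounds k {P} (t , 0≤t , t≤1 , P≡) =
  subst₂ ℚ._≤_ (ℚ.+-identityʳ (ι k)) (sym x≡) (ℚ.+-monoʳ-≤ (ι k) 0≤t) ,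
  subst (ℚ._≤ ι (suc k)) (sym x≡) (ℚ.+-monoʳ-≤ (ι k) t≤1) ,
  cong proj₂ P≡′
  where
  P≡′ : P ≡ (ι k ℚ.+ t , 0ℚ)
  P≡′ = trans P≡ (link-point k t)

  x≡ : proj₁ P ≡ ι k ℚ.+ t
  x≡ = cong proj₁ P≡′

-- Since `height b` is 1 or -1, it is its own inverse; so the second coordinate of a point on a
-- spoke determines its parameter.
spoke-param : ∀ b t → t ≡ 1ℚ ℚ.- height b ℚ.* ((1ℚ ℚ.- t) ℚ.* height b)
spoke-param 0F = solve 1 (λ t → t := con 1ℚ :- con 1ℚ :* ((con 1ℚ :- t) :* con 1ℚ)) refl
spoke-param 1F = solve 1 (λ t → t := con 1ℚ :- con (ℚ.- 1ℚ) :* ((con 1ℚ :- t) :* con (ℚ.- 1ℚ))) refl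

spoke-height-cancel : ∀ b {t t′} → (1ℚ ℚ.- t) ℚ.* height b ≡ (1ℚ ℚ.- t′) ℚ.* height b → t ≡ t′
spoke-height-cancel b {t} {t′} eq =
  trans (spoke-param b t) (trans (cong (λ y → 1ℚ ℚ.- height b ℚ.* y) eq) (sym (spoke-param b t′)))

-- The spokes of the two poles lie in opposite half-planes, so they can only
-- meet on the axis.
opposite-heights : ∀ {t t′} → t ℚ.≤ 1ℚ → t′ ℚ.≤ 1ℚ →
  (1ℚ ℚ.- t) ℚ.* height 0F ≡ (1ℚ ℚ.- t′) ℚ.* height 1F → t ≡ 1ℚ × t′ ≡ 1ℚ
opposite-heights {t} {t′} t≤1 t′≤1 eq = t≡1 , t′≡1
  where
  t≡ : t ≡ 1ℚ ℚ.+ (1ℚ ℚ.- t′)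
  t≡ = trans (spoke-param 0F t) (trans (cong (λ y → 1ℚ ℚ.- height 0F ℚ.* y) eq)
    (solve 1 (λ t′ → con 1ℚ :- con 1ℚ :* ((con 1ℚ :- t′) :* con (ℚ.- 1ℚ)) := con 1ℚ :+ (con 1ℚ :- t′)) refl t′))

  t≡1 : t ≡ 1ℚ
  t≡1 = ℚ.≤-antisym t≤1 (subst (1ℚ ℚ.≤_) (sym t≡) (ℚ.+-monoʳ-≤ 1ℚ (p≤1⇒0≤1-p t′≤1)))

  t′≡1 : t′ ≡ 1ℚ
  t′≡1 = spoke-height-cancel 1F
    (trans (sym eq) (cong (λ t → (1ℚ ℚ.- t) ℚ.* height 0F) t≡1))

-- For two spokes of one pole, `t ≡ 0ℚ` is the case of the pole itself, where all its spokes meet.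
*-cancelˡ-≥0 : ∀ {t p q} → 0ℚ ℚ.≤ t → t ℚ.* p ≡ t ℚ.* q → t ≡ 0ℚ ⊎ p ≡ q
*-cancelˡ-≥0 {t} 0≤t eq with ℚ.<-cmp 0ℚ t
... | tri> _ _ t<0 = contradiction (ℚ.<-≤-trans t<0 0≤t) (ℚ.<-irrefl refl)
... | tri≈ _ 0≡t _ = inj₁ (sym 0≡t)
... | tri< 0<t _ _ = inj₂ (ℚ.≤-antisym (cancel (ℚ.≤-reflexive eq)) (cancel (ℚ.≤-reflexive (sym eq))))
  where
  cancel : ∀ {p q} → t ℚ.* p ℚ.≤ t ℚ.* q → p ℚ.≤ q
  cancel = ℚ.*-cancelˡ-≤-pos t {{ℚ.positive 0<t}}

Meet : Segment → Segment → Point → Set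
Meet s s′ P = s ≡ s′ ⊎ ∃ λ q → Endpoint q s × Endpoint q s′ × P ≡ draw q

Meet-sym : ∀ {s s′ P} → Meet s s′ P → Meet s′ s P
Meet-sym (inj₁ s≡s′)              = inj₁ (sym s≡s′)
Meet-sym (inj₂ (q , e , e′ , P≡)) = inj₂ (q , e′ , e , P≡)

-- Equal heights give equal parameters; the first coordinates then agree only at parameter 0, which
-- is the pole, or for the same axis end.
meet-same-pole : ∀ b k l {P} → P ∈ₛ spoke b k → P ∈ₛ spoke b l → Meet (spoke b k) (spoke b l) P
meet-same-pole b k l (t , 0≤t , _ , P≡) (t′ , _ , _ , P≡′) =
  [ (λ t≡0 → inj₂ (pole b , inj₁ refl , inj₁ refl ,
      trans P≡ (comb-0 t≡0 (draw (pole b)) (draw (axis k)))))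
  , inj₁ ∘ cong (spoke b) ∘ ι-injective
  ] (*-cancelˡ-≥0 0≤t (trans (cong proj₁ eq) (cong (ℚ._* ι l) (sym t≡t′))))
  where
  eq : (t ℚ.* ι k , (1ℚ ℚ.- t) ℚ.* height b) ≡ (t′ ℚ.* ι l , (1ℚ ℚ.- t′) ℚ.* height b)
  eq = trans (sym (spoke-point b k t)) (trans (sym P≡) (trans P≡′ (spoke-point b l t′)))

  t≡t′ : t ≡ t′
  t≡t′ = spoke-height-cancel b (cong proj₂ eq)

meet-opposite-poles : ∀ k l {P} → P ∈ₛ spoke 0F k → P ∈ₛ spoke 1F l → Meet (spoke 0F k) (spoke 1F l) P
meet-opposite-poles k l {P} (t , _ , t≤1 , P≡) (t′ , _ , t′≤1 , P≡′) =
  inj₂ (axis k , inj₂ refl , inj₂ (draw-injective (trans (sym P≡k) P≡l)) , P≡k)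
  where
  eq : (1ℚ ℚ.- t) ℚ.* height 0F ≡ (1ℚ ℚ.- t′) ℚ.* height 1F
  eq = cong proj₂ (trans (sym (spoke-point 0F k t)) (trans (sym P≡) (trans P≡′ (spoke-point 1F l t′))))

  t≡1×t′≡1 = opposite-heights t≤1 t′≤1 eq

  P≡k : P ≡ draw (axis k)
  P≡k = trans P≡ (comb-1 (proj₁ t≡1×t′≡1) (draw (pole 0F)) (draw (axis k)))

  P≡l : P ≡ draw (axis l)
  P≡l = trans P≡′ (comb-1 (proj₂ t≡1×t′≡1) (draw (pole 1F)) (draw (axis l)))

-- No integer lies strictly between consecutive ones.
ι-between : ∀ {k l} → ι l ℚ.≤ ι k → ι k ℚ.≤ ι (suc l) → Endpoint (axis k) (link l)
ι-between {k} {l} l≤k k≤1+l with ℕ.m≤n⇒m<n∨m≡n (ι-cancel-≤ k≤1+l)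
... | inj₁ k<1+l = inj₁ (cong axis (ℕ.≤-antisym (ℕ.≤-pred k<1+l) (ι-cancel-≤ l≤k)))
... | inj₂ k≡1+l = inj₂ (cong axis k≡1+l)

-- A link has height zero, which a spoke attains only at its axis end; that end is an integer point,
-- hence an end of the link.
meet-spoke-link : ∀ b k l {P} → P ∈ₛ spoke b k → P ∈ₛ link l → Meet (spoke b k) (link l) P
meet-spoke-link b k l {P} (t , _ , _ , P≡) P∈l =
  inj₂ (axis k , inj₂ refl ,
    ι-between (subst (ι l ℚ.≤_) (cong proj₁ P≡k) l≤x) (subst (ℚ._≤ ι (suc l)) (cong proj₁ P≡k) x≤1+l) , P≡k)
  where
  bounds = ∈link⇒bounds l P∈l
  l≤x    = proj₁ bounds
  x≤1+l  = proj₁ (proj₂ bounds)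

  t≡1 : t ≡ 1ℚ
  -- Height zero is read as `0ℚ * height b`, the height of the spoke at parameter `1ℚ`.
  t≡1 = spoke-height-cancel b (trans (sym (cong proj₂ (trans P≡ (spoke-point b k t))))
    (trans (proj₂ (proj₂ bounds)) (sym (ℚ.*-zeroˡ (height b)))))

  P≡k : P ≡ draw (axis k)
  P≡k = trans P≡ (comb-1 t≡1 (draw (pole b)) (draw (axis k)))

-- The first coordinate of `P` is at least `ι l` and at most `ι (suc k)`, so `k < l` leaves only
-- `suc k ≡ l` and their common end.
meet-ordered-links : ∀ {k l P} → k ℕ.< l → P ∈ₛ link k → P ∈ₛ link l → Meet (link k) (link l) P
meet-ordered-links {k} {l} {P} k<l P∈k P∈l =
  inj₂ (axis l , inj₂ (cong axis (sym 1+k≡l)) , inj₁ refl ,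
    cong₂ _,_ (ℚ.≤-antisym (subst (λ j → proj₁ P ℚ.≤ ι j) 1+k≡l x≤1+k) l≤x) (proj₂ (proj₂ (∈link⇒bounds l P∈l))))
  where
  x≤1+k = proj₁ (proj₂ (∈link⇒bounds k P∈k))
  l≤x   = proj₁ (∈link⇒bounds l P∈l)

  1+k≡l : suc k ≡ l
  1+k≡l = ℕ.≤-antisym k<l (ι-cancel-≤ (ℚ.≤-trans l≤x x≤1+k))

meet : ∀ s s′ {P} → P ∈ₛ s → P ∈ₛ s′ → Meet s s′ P
meet (spoke 0F k) (spoke 0F l) P∈ P∈′ = meet-same-pole 0F k l P∈ P∈′
meet (spoke 1F k) (spoke 1F l) P∈ P∈′ = meet-same-pole 1F k l P∈ P∈′
meet (spoke 0F k) (spoke 1F l) P∈ P∈′ = meet-opposite-poles k l P∈ P∈′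
meet (spoke 1F k) (spoke 0F l) P∈ P∈′ = Meet-sym (meet-opposite-poles l k P∈′ P∈)
meet (spoke b k)  (link l)     P∈ P∈′ = meet-spoke-link b k l P∈ P∈′
meet (link k)     (spoke b l)  P∈ P∈′ = Meet-sym (meet-spoke-link b l k P∈′ P∈)
meet (link k)     (link l)     P∈ P∈′ with ℕ.<-cmp k l
... | tri< k<l _ _  = meet-ordered-links k<l P∈ P∈′
... | tri≈ _ refl _ = inj₁ refl
... | tri> _ _ l<k  = Meet-sym (meet-ordered-links l<k P∈′ P∈)

source∈ : ∀ s → draw (source s) ∈ₛ s
source∈ s = 0ℚ , ℚ.≤-refl , ℚ.nonNegative⁻¹ 1ℚ , sym (comb-0 refl (draw (source s)) (draw (target s)))

incident : ∀ q → ∃ λ s → source s ≡ q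
incident (pole b) = spoke b 0 , refl
incident (axis k) = link k , refl

-- Reduces to two segments meeting: `q` is the source of some `s′`, so either `s` is `s′`, or they
-- share an end drawn at the same point as `q`, which is `q` by injectivity.
site-on-segment : ∀ q s → draw q ∈ₛ s → Endpoint q s
site-on-segment q s q∈s with s′ , refl ← incident q =
  [ inj₁ ∘ sym ∘ cong source
  , (λ { (r , e , _ , q≡r) → subst (λ r → Endpoint r s) (sym (draw-injective q≡r)) e })
  ] (meet s s′ q∈s (source∈ s′))

-- Planarity by placement.

Joins : Segment → Site → Site → Set
Joins s q r = (q ≡ source s × r ≡ target s) ⊎ (r ≡ source s × q ≡ target s)

Joins-sym : ∀ {s q r} → Joins s q r → Joins s r q
Joins-sym (inj₁ e) = inj₂ e
Joins-sym (inj₂ e) = inj₁ e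

Joins⇒∈ : ∀ {s q r P} → Joins s q r → OnSeg P (draw q) (draw r) → P ∈ₛ s
Joins⇒∈ (inj₁ (refl , refl)) P∈ = P∈
Joins⇒∈ (inj₂ (refl , refl)) P∈ = OnSeg-sym P∈

Joins⇒endpoint : ∀ {s q r x} → Joins s q r → Endpoint x s → x ≡ q ⊎ x ≡ r
Joins⇒endpoint (inj₁ (refl , refl)) e        = e
Joins⇒endpoint (inj₂ (refl , refl)) (inj₁ e) = inj₂ e
Joins⇒endpoint (inj₂ (refl , refl)) (inj₂ e) = inj₁ e

Joins-unique : ∀ {s q r q′ r′} → Joins s q r → Joins s q′ r′ →
  (q ≡ q′ × r ≡ r′) ⊎ (q ≡ r′ × r ≡ q′)
Joins-unique (inj₁ (refl , refl)) (inj₁ (refl , refl)) = inj₁ (refl , refl)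
Joins-unique (inj₁ (refl , refl)) (inj₂ (refl , refl)) = inj₂ (refl , refl)
Joins-unique (inj₂ (refl , refl)) (inj₁ (refl , refl)) = inj₂ (refl , refl)
Joins-unique (inj₂ (refl , refl)) (inj₂ (refl , refl)) = inj₁ (refl , refl)

-- Both conditions on a drawing pull back along an injective placement: `site-on-segment` handles a
-- vertex on an edge, `meet` handles two edges.
placed⇒planar : ∀ {n m} (G : NMGraph n m) (place : Fin (size G) → Site) →
  (∀ {x y} → place x ≡ place y → x ≡ y) →
  (∀ x y → Adj G x y → ∃ λ s → Joins s (place x) (place y)) → Planar G
placed⇒planar G place place-injective joins = record
  { pos       = draw ∘ place
  ; pos-inj   = λ x y → place-injective ∘ draw-injective
  ; vtx-edge  = vtx-edge
  ; edge-edge = edge-edge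
  }
  where
  V = Fin (size G)

  unplace : ∀ {x a b} → place x ≡ place a ⊎ place x ≡ place b → x ≡ a ⊎ x ≡ b
  unplace (inj₁ e) = inj₁ (place-injective e)
  unplace (inj₂ e) = inj₂ (place-injective e)

  vtx-edge : ∀ v a b → Adj G a b → OnSeg (draw (place v)) (draw (place a)) (draw (place b)) →
             v ≡ a ⊎ v ≡ b
  vtx-edge v a b ab v∈ with joins a b ab
  ... | s , j = unplace (Joins⇒endpoint j (site-on-segment (place v) s (Joins⇒∈ j v∈)))

  edge-edge : ∀ a b c d → Adj G a b → Adj G c d →
    ¬ (a ≡ c × b ≡ d) → ¬ (a ≡ d × b ≡ c) →
    ∀ P → OnSeg P (draw (place a)) (draw (place b)) → OnSeg P (draw (place c)) (draw (place d)) →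
    Σ V λ v → (v ≡ a ⊎ v ≡ b) × (v ≡ c ⊎ v ≡ d) × P ≡ draw (place v)
  edge-edge a b c d ab cd ¬same ¬swapped P P∈ab P∈cd
    with s , j ← joins a b ab | s′ , j′ ← joins c d cd =
    -- Two edges on one segment have the same ends up to order, which the two hypotheses on
    -- `a b c d` exclude.
    [ ⊥-elim ∘ (λ { refl → distinct (Joins-unique j j′) })
    , (λ { (q , e , e′ , P≡) → common e′ P≡ (Joins⇒endpoint j e) j′ })
    ] (meet s s′ (Joins⇒∈ j P∈ab) (Joins⇒∈ j′ P∈cd))
    where
    distinct : ¬ ((place a ≡ place c × place b ≡ place d) ⊎ (place a ≡ place d × place b ≡ place c))
    distinct (inj₁ (p , q)) = ¬same (place-injective p , place-injective q)
    distinct (inj₂ (p , q)) = ¬swapped (place-injective p , place-injective q)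

    common : ∀ {q s′} → Endpoint q s′ → P ≡ draw q → q ≡ place a ⊎ q ≡ place b →
      Joins s′ (place c) (place d) → Σ V λ v → (v ≡ a ⊎ v ≡ b) × (v ≡ c ⊎ v ≡ d) × P ≡ draw (place v)
    common e′ P≡ (inj₁ refl) j′ = a , inj₁ refl , unplace (Joins⇒endpoint j′ e′) , P≡
    common e′ P≡ (inj₂ refl) j′ = b , inj₂ refl , unplace (Joins⇒endpoint j′ e′) , P≡

-- The graph with paired rims.

flipLab-involutive : ∀ {n m} (l : Lab n m) → flipLab (flipLab l) ≡ l
flipLab-involutive (arcOut i) = refl
flipLab-involutive (arcIn i)  = refl
flipLab-involutive (edge j)   = refl

just-cancel : ∀ {n m} {x : Maybe (Lab n m)} {k l} → x ≡ just k → x ≡ just l → k ≡ l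
just-cancel p q = Maybe.just-injective (trans (sym p) q)

-- `N` counts the pairs of rims; a rim is a pair index and a side, and each pair has one middle
-- vertex.
Vertex : ℕ → Set
Vertex N = Fin 2 ⊎ (Fin N × Fin 2 ⊎ Fin N)

pattern hub b   = inj₁ b
pattern rim i e = inj₂ (inj₁ (i , e))
pattern mid i   = inj₂ (inj₂ i)

enumeration : ∀ {N} → Fin (2 + (N * 2 + N)) ↔ Vertex N
enumeration = (↔-id _ ⊎-↔ ((Fin.*↔× ⊎-↔ ↔-id _) ↔-∘ Fin.+↔⊎)) ↔-∘ Fin.+↔⊎

-- A hub's label to a rim depends only on the pair and the middle vertex's label only on the side:
-- the hubs tell pairs apart, the middle vertices tell sides apart.
module PairedRims {n m N} (hubLab : Fin 2 → Fin N → Lab n m) (midLab : Fin 2 → Lab n m) where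

  midRim : Fin N → Fin N → Fin 2 → Maybe (Lab n m)
  midRim i j e with i Fin.≟ j
  ... | yes _ = just (midLab e)
  ... | no _  = nothing

  label : Vertex N → Vertex N → Maybe (Lab n m)
  label (hub _)   (hub _)   = nothing
  label (hub b)   (rim i e) = just (hubLab b i)
  label (hub _)   (mid _)   = nothing
  label (rim i e) (hub b)   = just (flipLab (hubLab b i))
  label (rim _ _) (rim _ _) = nothing
  label (rim j e) (mid i)   = Maybe.map flipLab (midRim i j e)
  label (mid _)   (hub _)   = nothing
  label (mid i)   (rim j e) = midRim i j e
  label (mid _)   (mid _)   = nothing

  label-irrefl : ∀ x → label x x ≡ nothing
  label-irrefl (hub _)   = refl
  label-irrefl (rim _ _) = refl
  label-irrefl (mid _)   = refl

  label-sym : ∀ x y → label y x ≡ Maybe.map flipLab (label x y)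
  label-sym (hub _)   (hub _)   = refl
  label-sym (hub _)   (rim _ _) = refl
  label-sym (hub _)   (mid _)   = refl
  label-sym (rim i _) (hub b)   = cong just (sym (flipLab-involutive (hubLab b i)))
  label-sym (rim _ _) (rim _ _) = refl
  label-sym (rim j e) (mid i) with midRim i j e
  ... | just l  = cong just (sym (flipLab-involutive l))
  ... | nothing = refl
  label-sym (mid _)   (hub _)   = refl
  label-sym (mid _)   (rim _ _) = refl
  label-sym (mid _)   (mid _)   = refl

  vertex : Fin (2 + (N * 2 + N)) → Vertex N
  vertex = Inverse.to enumeration

  vertex-injective : ∀ {x y} → vertex x ≡ vertex y → x ≡ y
  vertex-injective = Injection.injective (↔⇒↣ enumeration)

  graph : NMGraph n m
  graph = record
    { size   = 2 + (N * 2 + N)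
    ; lab    = λ x y → label (vertex x) (vertex y)
    ; noLoop = λ x → label-irrefl (vertex x)
    ; labSym = λ x y → label-sym (vertex x) (vertex y)
    }

  -- Edges and triangle-freeness.

  -- Lists every adjacency once, oriented towards its rim.
  data Edge : Vertex N → Vertex N → Set where
    hub-rim : ∀ b i e → Edge (hub b) (rim i e)
    mid-rim : ∀ i e → Edge (mid i) (rim i e)

  midRim⇒≡ : ∀ i j e {l} → midRim i j e ≡ just l → i ≡ j
  midRim⇒≡ i j e eq with i Fin.≟ j
  midRim⇒≡ i j e eq | yes i≡j = i≡j
  midRim⇒≡ i j e () | no _

  label⇒edge : ∀ x y {l} → label x y ≡ just l → Edge x y ⊎ Edge y x
  label⇒edge (hub b)   (rim i e) _  = inj₁ (hub-rim b i e)
  label⇒edge (rim i e) (hub b)   _  = inj₂ (hub-rim b i e)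
  label⇒edge (mid i)   (rim j e) eq with refl ← midRim⇒≡ i j e eq = inj₁ (mid-rim i e)
  label⇒edge (rim j e) (mid i)   eq with midRim i j e in eq′
  ... | just _ with refl ← midRim⇒≡ i j e eq′ = inj₂ (mid-rim i e)

  isRim : Vertex N → Bool
  isRim (hub _)   = false
  isRim (rim _ _) = true
  isRim (mid _)   = false

  edge-bichromatic : ∀ {u v} → Edge u v → isRim u ≢ isRim v
  edge-bichromatic (hub-rim _ _ _) ()
  edge-bichromatic (mid-rim _ _) ()

  bipartite : ∀ x y → Adj graph x y → isRim (vertex x) ≢ isRim (vertex y)
  bipartite x y (_ , eq) with label⇒edge (vertex x) (vertex y) eq
  ... | inj₁ e = edge-bichromatic e
  ... | inj₂ e = edge-bichromatic e ∘ sym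

  triangleFree : TriangleFree graph
  triangleFree x y z xy yz xz = no-three-colours (bipartite x y xy) (bipartite y z yz) (bipartite x z xz)
    where
    -- With two colours, some two of three vertices agree.
    no-three-colours : ∀ {a b c : Bool} → a ≢ b → b ≢ c → ¬ a ≢ c
    no-three-colours {false} {false} a≢b _ _ = a≢b refl
    no-three-colours {true}  {true}  a≢b _ _ = a≢b refl
    no-three-colours {false} {true} {false} _ _ a≢c = a≢c refl
    no-three-colours {false} {true} {true}  _ b≢c _ = b≢c refl
    no-three-colours {true} {false} {true}  _ _ a≢c = a≢c refl
    no-three-colours {true} {false} {false} _ b≢c _ = b≢c refl

  -- Planarity of the graph.

  -- Of the three places of a pair, the middle one is left free for its middle vertex.
  slot : Fin 2 → Fin 3
  slot 0F = 0F
  slot 1F = 2F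

  slot-injective : ∀ {e f} → slot e ≡ slot f → e ≡ f
  slot-injective {0F} {0F} _ = refl
  slot-injective {1F} {1F} _ = refl
  slot-injective {0F} {1F} ()
  slot-injective {1F} {0F} ()

  slot≢1 : ∀ {e} → slot e ≢ 1F
  slot≢1 {0F} ()
  slot≢1 {1F} ()

  -- The position is `3 * i + c`, so each pair occupies its own three consecutive integers.
  axisAt : Fin N → Fin 3 → Site
  axisAt i c = axis (toℕ (combine i c))

  axisAt-injective : ∀ {i j c d} → axisAt i c ≡ axisAt j d → i ≡ j × c ≡ d
  axisAt-injective {i} {j} {c} {d} eq = Fin.combine-injective i c j d (Fin.toℕ-injective (axis-injective eq))

  place : Vertex N → Site
  place (hub b)   = pole b
  place (rim i e) = axisAt i (slot e)
  place (mid i)   = axisAt i 1F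

  place-injective : ∀ {x y} → place x ≡ place y → x ≡ y
  place-injective {hub b}   {hub .b}  refl = refl
  place-injective {hub b}   {rim i e} ()
  place-injective {hub b}   {mid i}   ()
  place-injective {rim i e} {rim j f} eq with refl , p ← axisAt-injective eq = cong (rim i) (slot-injective p)
  place-injective {rim i e} {mid j}   eq = contradiction (proj₂ (axisAt-injective eq)) slot≢1
  place-injective {mid i}   {rim j f} eq = contradiction (sym (proj₂ (axisAt-injective eq))) slot≢1
  place-injective {mid i}   {mid j}   eq = cong mid (proj₁ (axisAt-injective eq))

  axisAt-next : ∀ i (c d : Fin 3) → toℕ d ≡ suc (toℕ c) → axisAt i d ≡ axis (suc (toℕ (combine i c)))
  axisAt-next i c d d≡1+c = cong axis (trans (Fin.toℕ-combine i d)
    (trans (cong (3 * toℕ i +_) d≡1+c)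
    (trans (ℕ.+-suc _ _) (cong suc (sym (Fin.toℕ-combine i c))))))

  edge⇒joins : ∀ {x y} → Edge x y → ∃ λ s → Joins s (place x) (place y)
  edge⇒joins (hub-rim b i e) = spoke b (toℕ (combine i (slot e))) , inj₁ (refl , refl)
  -- Links point to the right: the middle vertex is the target of the link from rim 0 and the source
  -- of the link to rim 1.
  edge⇒joins (mid-rim i 0F)  = link (toℕ (combine {n = 3} i 0F)) , inj₂ (refl , axisAt-next i 0F 1F refl)
  edge⇒joins (mid-rim i 1F)  = link (toℕ (combine {n = 3} i 1F)) , inj₁ (refl , axisAt-next i 1F 2F refl)

  planar : Planar graph
  planar = placed⇒planar graph (place ∘ vertex) (vertex-injective ∘ place-injective) joins
    where
    joins : ∀ x y → Adj graph x y → ∃ λ s → Joins s (place (vertex x)) (place (vertex y))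
    joins x y (_ , eq) with label⇒edge (vertex x) (vertex y) eq
    ... | inj₁ e = edge⇒joins e
    ... | inj₂ e with s , j ← edge⇒joins e = s , Joins-sym j

  -- The lower bound on homomorphic images.

  midRim-refl : ∀ i e → midRim i i e ≡ just (midLab e)
  midRim-refl i e with i Fin.≟ i
  ... | yes _   = refl
  ... | no i≢i  = contradiction refl i≢i

  module _ (i₀ : Fin N) (hubs-differ : hubLab 0F i₀ ≢ hubLab 1F i₀)
           (hubLab-separates : ∀ {i j} → (∀ b → hubLab b i ≡ hubLab b j) → i ≡ j)
           (midLab-injective : ∀ {e f} → midLab e ≡ midLab f → e ≡ f)
           (H : NMGraph n m) (h : Hom graph H)
           where

    image : Vertex N → Fin (size H)
    image = proj₁ h ∘ Inverse.from enumeration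

    image-lab : ∀ x y {l} → label x y ≡ just l → lab H (image x) (image y) ≡ just l
    image-lab x y eq = proj₂ h _ _ _ (trans (cong₂ label (vertex-from x) (vertex-from y)) eq)
      where
      vertex-from : ∀ x → vertex (Inverse.from enumeration x) ≡ x
      vertex-from x = Inverse.inverseˡ enumeration refl

    -- Otherwise `H` would have a loop.
    adjacent-images-differ : ∀ x y {l} → label x y ≡ just l → image x ≢ image y
    adjacent-images-differ x y eq same
      with () ← trans (sym (noLoop H (image y))) (subst (λ v → lab H v (image y) ≡ _) same (image-lab x y eq))

    -- If the hubs were identified, a single ordered pair in `H` would carry both of their labels to
    -- a rim of pair `i₀`.
    hubs-apart : image (hub 0F) ≢ image (hub 1F)
    hubs-apart same = hubs-differ (just-cancel
      (image-lab (hub 0F) (rim i₀ 0F) refl)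
      (subst (λ v → lab H v (image (rim i₀ 0F)) ≡ _) (sym same) (image-lab (hub 1F) (rim i₀ 0F) refl)))

    -- An ordered pair in `H` has at most one label, so a common neighbour with different labels to
    -- two vertices separates their images.
    same-image⇒same-label : ∀ x {y y′ l l′} → image y ≡ image y′ →
      label x y ≡ just l → label x y′ ≡ just l′ → l ≡ l′
    same-image⇒same-label x {y} {y′} same eq eq′ = just-cancel (image-lab x y eq)
      (subst (λ v → lab H (image x) v ≡ _) (sym same) (image-lab x y′ eq′))

    -- The count runs over hubs and rims; the middle vertices enter only as witnesses that separate
    -- rims.
    outer : Fin 2 ⊎ Fin N × Fin 2 → Vertex N
    outer = map₂ inj₁

    image-outer-injective : ∀ {x y} → image (outer x) ≡ image (outer y) → x ≡ y
    image-outer-injective {inj₁ 0F} {inj₁ 0F} _ = refl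
    image-outer-injective {inj₁ 0F} {inj₁ 1F} same = contradiction same hubs-apart
    image-outer-injective {inj₁ 1F} {inj₁ 0F} same = contradiction (sym same) hubs-apart
    image-outer-injective {inj₁ 1F} {inj₁ 1F} _ = refl
    image-outer-injective {inj₁ b} {inj₂ (i , e)} same =
      contradiction same (adjacent-images-differ (hub b) (rim i e) refl)
    image-outer-injective {inj₂ (i , e)} {inj₁ b} same =
      contradiction same (adjacent-images-differ (rim i e) (hub b) refl)
    image-outer-injective {inj₂ (i , e)} {inj₂ (j , f)} same
      -- The two hubs first force both rims into one pair; its middle vertex then forces the same
      -- side.
      with refl ← hubLab-separates (λ b → same-image⇒same-label (hub b) {rim i e} {rim j f} same refl refl)
      = cong (λ e → inj₂ (i , e)) (midLab-injective
          (same-image⇒same-label (mid i) {rim i e} {rim i f} same (midRim-refl i e) (midRim-refl i f)))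

    outer-enumeration : Fin (2 + N * 2) ↔ (Fin 2 ⊎ Fin N × Fin 2)
    outer-enumeration = (↔-id _ ⊎-↔ Fin.*↔×) ↔-∘ Fin.+↔⊎

    order-bound : 2 + N * 2 ≤ size H
    order-bound = Fin.injective⇒≤ {f = image ∘ outer ∘ Inverse.to outer-enumeration}
      (Injection.injective (↔⇒↣ outer-enumeration) ∘ image-outer-injective)

-- Numbering the labels and choosing the labelling.

Fin↔labels : ∀ n m → Fin (2 * n + m) ↔ (Fin 2 × Fin n ⊎ Fin m)
Fin↔labels n m = (Fin.*↔× ⊎-↔ ↔-id _) ↔-∘ Fin.+↔⊎

-- An arc type gives two labels, one per direction, which is why `2 * n + m` is the number of
-- labels.
toLab : ∀ {n m} → Fin 2 × Fin n ⊎ Fin m → Lab n m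
toLab (inj₁ (0F , i)) = arcOut i
toLab (inj₁ (1F , i)) = arcIn i
toLab (inj₂ j)        = edge j

toLab-injective : ∀ {n m} {x y : Fin 2 × Fin n ⊎ Fin m} → toLab x ≡ toLab y → x ≡ y
toLab-injective {x = inj₁ (0F , _)} {inj₁ (0F , _)} refl = refl
toLab-injective {x = inj₁ (1F , _)} {inj₁ (1F , _)} refl = refl
toLab-injective {x = inj₂ _}        {inj₂ _}        refl = refl
toLab-injective {x = inj₁ (0F , _)} {inj₁ (1F , _)} ()
toLab-injective {x = inj₁ (1F , _)} {inj₁ (0F , _)} ()
toLab-injective {x = inj₁ (0F , _)} {inj₂ _}        ()
toLab-injective {x = inj₁ (1F , _)} {inj₂ _}        ()
toLab-injective {x = inj₂ _}        {inj₁ (0F , _)} ()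
toLab-injective {x = inj₂ _}        {inj₁ (1F , _)} ()

nthLab : ∀ {n m} → Fin (2 * n + m) → Lab n m
nthLab {n} {m} = toLab ∘ Inverse.to (Fin↔labels n m)

nthLab-injective : ∀ {n m} {k l : Fin (2 * n + m)} → nthLab {n} k ≡ nthLab l → k ≡ l
nthLab-injective {n} {m} = Injection.injective (↔⇒↣ (Fin↔labels n m)) ∘ toLab-injective

-- A pair index below `p * p` is read as two base-`p` digits, which number its labels from the two
-- hubs.
digit : ∀ p → Fin 2 → Fin (p * p) → Fin p
digit p 0F i = proj₁ (remQuot {p} p i)
digit p 1F i = proj₂ (remQuot {p} p i)

digit-injective : ∀ p {i j : Fin (p * p)} → (∀ b → digit p b i ≡ digit p b j) → i ≡ j
digit-injective p eq = Injection.injective (↔⇒↣ (Fin.*↔× {p} {p})) (cong₂ _,_ (eq 0F) (eq 1F))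

theorem6 : (n m : ℕ) → 3 ≤ 2 * n + m →
    Σ (NMGraph n m) λ G →
    TriangleFree G × Planar G × ChromaticAtLeast G (2 * (2 * n + m) ^ 2 + 2)
theorem6 n m 3≤p = graph , triangleFree , planar ,
  λ H h → subst (_≤ size H) count
    (order-bound i₀ hubs-differ (λ eq → digit-injective p (nthLab-injective {n} ∘ eq)) (two-injective ∘ nthLab-injective {n}) H h)
  where
  p : ℕ
  p = 2 * n + m

  2≤p : 2 ≤ p
  2≤p = ℕ.<⇒≤ 3≤p

  -- Two distinct label numbers, used both for the middle vertices and for `i₀`.
  two : Fin 2 → Fin p
  two e = Fin.inject≤ e 2≤p

  two-injective : ∀ {e f} → two e ≡ two f → e ≡ f
  two-injective = Fin.inject≤-injective 2≤p 2≤p _ _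

  open PairedRims {N = p * p} (λ b i → nthLab {n} (digit p b i)) (nthLab {n} ∘ two)

  -- The pair with two different digits, whose rims receive different labels from the hubs.
  i₀ : Fin (p * p)
  i₀ = combine (two 0F) (two 1F)

  i₀-digits : remQuot {p} p i₀ ≡ (two 0F , two 1F)
  i₀-digits = Fin.remQuot-combine (two 0F) (two 1F)

  hubs-differ : nthLab {n} (digit p 0F i₀) ≢ nthLab {n} (digit p 1F i₀)
  hubs-differ eq with () ← two-injective
    (trans (sym (cong proj₁ i₀-digits)) (trans (nthLab-injective {n} eq) (cong proj₂ i₀-digits)))

  count : 2 + p * p * 2 ≡ 2 * p ^ 2 + 2
  count = trans (ℕ.+-comm 2 (p * p * 2)) (cong (_+ 2)
    (trans (ℕ.*-comm (p * p) 2) (cong (λ q → 2 * (p * q)) (sym (ℕ.*-identityʳ p)))))
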